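{- For every integer $n\ge 1$, let $M(n)=M(n)(X,q)$ be the $n\times n$ tridiagonal matrix with entries ($1\le i,j\le n$) $$ M(n)_{i,j}=\begin{cases} 1 & \text{if } i-j=0,\\ \sqrt{X}\,q^{(i-1)/2} & \text{if } i-j=-1,\\ \sqrt{X}\,q^{(i-2)/2} & \text{if } i-j=1,\\ 0 & \text{otherwise.}\end{cases} $$ Then $$ \det M(n)(X,q)=\sum_{a=0}^{\lfloor n/2\rfloor}\frac{(-1)^a X^a q^{a(a-1)}\,(1-q^{n-a})(1-q^{n-a-1})\cdots(1-q^{n-2a+1})}{(1-q)(1-q^2)\cdots(1-q^a)}. $$
   Context: $X$ and $q$ are indeterminates; $\sqrt{X}$ and $q^{1/2}$ denote fixed square roots of $X$ and $q$, and $q^{k/2}=(q^{1/2})^k$ for integers $k$. In the $a$-th summand, the product in the numerator $(1-q^{n-a})(1-q^{n-a-1})\cdots(1-q^{n-2a+1})$ has exactly $a$ factors $1-q^{m}$, with $m$ running from $n-2a+1$ to $n-a$; the product in the denominator is $\prod_{k=1}^{a}(1-q^k)$. For $a=0$ both products are empty and equal $1$, so the $a=0$ summand is $1$. -}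

module Defs where

open import Algebra.Bundles
  using (CommutativeMonoid; CommutativeRing; CommutativeSemigroup)
open import Algebra.Structures using (IsAbelianGroup)
open import Data.Bool.Base using (if_then_else_)
open import Data.Fin.Base using (Fin; zero; suc; toℕ; punchIn)
open import Data.List.Base using (List; []; _∷_; map)
open import Data.Nat.Base using (ℕ; zero; suc; _∸_; _≡ᵇ_)
  renaming (_*_ to _·_)
open import Data.Product.Base using (_,_)
open import Data.Vec.Functional using (Vector)
open import Level using (_⊔_)
open import Relation.Binary.Structures using (IsEquivalence)

import Algebra.Properties.CommutativeMonoid.Sum
import Algebra.Properties.CommutativeSemigroup
import Algebra.Properties.Group
import Algebra.Properties.Ring
import Algebra.Properties.Semiring.Exp
import Algebra.Solver.Ring.NaturalCoefficients.Default
import Relation.Binary.Reasoning.Setoid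

module Operations {c ℓ} (R : CommutativeRing c ℓ) where
  open CommutativeRing R public hiding (zero)
  open Algebra.Properties.Semiring.Exp semiring public using (_^_)
  open Algebra.Properties.CommutativeMonoid.Sum +-commutativeMonoid public
    using (sum)
  open Algebra.Properties.CommutativeMonoid.Sum *-commutativeMonoid public
    using () renaming (sum to product)

  -- Cofactor expansion along the first row.
  det : ∀ {n} → (Fin n → Fin n → Carrier) → Carrier
  det {zero}  A = 1#
  det {suc n} A = sum {suc n} λ j →
    (- 1#) ^ toℕ j * A zero j * det (λ r s → A (suc r) (punchIn j s))

module Polynomial {c ℓ} (R : CommutativeRing c ℓ) where
  private
    open module R = CommutativeRing R using (Carrier; 0#; 1#; _≈_)
    module RG = Algebra.Properties.Group R.+-group

  -- Coefficients in order of increasing degree; trailing zeros are allowed,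
  -- so polynomials are compared by their coefficients.
  Poly : Set c
  Poly = List Carrier

  coeff : Poly → ℕ → Carrier
  coeff []      _       = 0#
  coeff (a ∷ p) zero    = a
  coeff (a ∷ p) (suc n) = coeff p n

  infix 4 _≋_
  record _≋_ (p q : Poly) : Set ℓ where
    constructor pointwise
    field at : ∀ n → coeff p n ≈ coeff q n
  open _≋_ public

  infixl 6 _⊕_
  infixl 7 _⊗_ _⊙_

  _⊕_ : Poly → Poly → Poly
  []      ⊕ q       = q
  (a ∷ p) ⊕ []      = a ∷ p
  (a ∷ p) ⊕ (b ∷ q) = (a R.+ b) ∷ (p ⊕ q)

  ⊖_ : Poly → Poly
  ⊖_ = map (R.-_)

  _⊙_ : Carrier → Poly → Poly
  a ⊙ p = map (a R.*_) p

  _⊗_ : Poly → Poly → Poly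
  []      ⊗ q = []
  (a ∷ p) ⊗ q = (a ⊙ q) ⊕ (0# ∷ (p ⊗ q))

  𝟙 : Poly
  𝟙 = 1# ∷ []

  constant : Carrier → Poly
  constant a = a ∷ []

  indeterminate : Poly
  indeterminate = 0# ∷ 1# ∷ []

  coeff-⊕ : ∀ p q n → coeff (p ⊕ q) n ≈ coeff p n R.+ coeff q n
  coeff-⊕ []      q       n       = R.sym (R.+-identityˡ _)
  coeff-⊕ (a ∷ p) []      n       = R.sym (R.+-identityʳ _)
  coeff-⊕ (a ∷ p) (b ∷ q) zero    = R.refl
  coeff-⊕ (a ∷ p) (b ∷ q) (suc n) = coeff-⊕ p q n

  coeff-⊖ : ∀ p n → coeff (⊖ p) n ≈ R.- coeff p n
  coeff-⊖ []      n       = R.sym RG.ε⁻¹≈ε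
  coeff-⊖ (a ∷ p) zero    = R.refl
  coeff-⊖ (a ∷ p) (suc n) = coeff-⊖ p n

  coeff-⊙ : ∀ a p n → coeff (a ⊙ p) n ≈ a R.* coeff p n
  coeff-⊙ a []      n       = R.sym (R.zeroʳ a)
  coeff-⊙ a (b ∷ p) zero    = R.refl
  coeff-⊙ a (b ∷ p) (suc n) = coeff-⊙ a p n

  ≋-isEquivalence : IsEquivalence _≋_
  ≋-isEquivalence = record
    { refl  = pointwise λ n → R.refl
    ; sym   = λ e → pointwise λ n → R.sym (at e n)
    ; trans = λ e f → pointwise λ n → R.trans (at e n) (at f n)
    }

  ⊕-cong : ∀ {p p′ q q′} → p ≋ p′ → q ≋ q′ → p ⊕ q ≋ p′ ⊕ q′
  ⊕-cong {p} {p′} {q} {q′} e f = pointwise λ n →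
    R.trans (coeff-⊕ p q n)
      (R.trans (R.+-cong (at e n) (at f n)) (R.sym (coeff-⊕ p′ q′ n)))

  ⊕-assoc : ∀ p q r → (p ⊕ q) ⊕ r ≋ p ⊕ (q ⊕ r)
  ⊕-assoc p q r = pointwise λ n → begin
    coeff ((p ⊕ q) ⊕ r) n                  ≈⟨ coeff-⊕ (p ⊕ q) r n ⟩
    coeff (p ⊕ q) n R.+ coeff r n          ≈⟨ R.+-congʳ (coeff-⊕ p q n) ⟩
    coeff p n R.+ coeff q n R.+ coeff r n  ≈⟨ R.+-assoc _ _ _ ⟩
    coeff p n R.+ (coeff q n R.+ coeff r n) ≈⟨ R.+-congˡ (coeff-⊕ q r n) ⟨
    coeff p n R.+ coeff (q ⊕ r) n          ≈⟨ coeff-⊕ p (q ⊕ r) n ⟨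
    coeff (p ⊕ (q ⊕ r)) n                  ∎
    where open Relation.Binary.Reasoning.Setoid R.setoid

  ⊕-comm : ∀ p q → p ⊕ q ≋ q ⊕ p
  ⊕-comm p q = pointwise λ n →
    R.trans (coeff-⊕ p q n)
      (R.trans (R.+-comm _ _) (R.sym (coeff-⊕ q p n)))

  ⊕-identityʳ : ∀ p → p ⊕ [] ≋ p
  ⊕-identityʳ p = ⊕-comm p []

  ⊕-inverseˡ : ∀ p → (⊖ p) ⊕ p ≋ []
  ⊕-inverseˡ p = pointwise λ n →
    R.trans (coeff-⊕ (⊖ p) p n)
      (R.trans (R.+-congʳ (coeff-⊖ p n)) (R.-‿inverseˡ _))

  ⊕-inverseʳ : ∀ p → p ⊕ (⊖ p) ≋ []
  ⊕-inverseʳ p = IsEquivalence.trans ≋-isEquivalence (⊕-comm p (⊖ p)) (⊕-inverseˡ p)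

  ⊖-cong : ∀ {p q} → p ≋ q → ⊖ p ≋ ⊖ q
  ⊖-cong {p} {q} e = pointwise λ n →
    R.trans (coeff-⊖ p n) (R.trans (R.-‿cong (at e n)) (R.sym (coeff-⊖ q n)))

  ⊕-isAbelianGroup : IsAbelianGroup _≋_ _⊕_ [] ⊖_
  ⊕-isAbelianGroup = record
    { isGroup = record
      { isMonoid = record
        { isSemigroup = record
          { isMagma = record { isEquivalence = ≋-isEquivalence ; ∙-cong = ⊕-cong }
          ; assoc = ⊕-assoc
          }
        ; identity = (λ p → IsEquivalence.refl ≋-isEquivalence) , ⊕-identityʳ
        }
      ; inverse = ⊕-inverseˡ , ⊕-inverseʳ
      ; ⁻¹-cong = ⊖-cong
      }
    ; comm = ⊕-comm
    }

  private
    module A = IsAbelianGroup ⊕-isAbelianGroup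

    ⊕-commutativeSemigroup : CommutativeSemigroup c ℓ
    ⊕-commutativeSemigroup = CommutativeMonoid.commutativeSemigroup
      (record { isCommutativeMonoid = A.isCommutativeMonoid })

    open Algebra.Properties.CommutativeSemigroup ⊕-commutativeSemigroup
      using (interchange; x∙yz≈y∙xz)
    open Relation.Binary.Reasoning.Setoid A.setoid

  ∷-cong : ∀ {a b p q} → a ≈ b → p ≋ q → a ∷ p ≋ b ∷ q
  ∷-cong e f = pointwise λ { zero → e ; (suc n) → at f n }

  0∷[] : 0# ∷ [] ≋ []
  0∷[] = pointwise λ { zero → R.refl ; (suc n) → R.refl }

  0∷-⊕ : ∀ p q → 0# ∷ (p ⊕ q) ≋ (0# ∷ p) ⊕ (0# ∷ q)
  0∷-⊕ p q = ∷-cong (R.sym (R.+-identityˡ 0#)) A.refl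

  ⊙-cong : ∀ {a b p q} → a ≈ b → p ≋ q → a ⊙ p ≋ b ⊙ q
  ⊙-cong {a} {b} {p} {q} e f = pointwise λ n →
    R.trans (coeff-⊙ a p n)
      (R.trans (R.*-cong e (at f n)) (R.sym (coeff-⊙ b q n)))

  ⊙-distribˡ : ∀ a p q → a ⊙ (p ⊕ q) ≋ (a ⊙ p) ⊕ (a ⊙ q)
  ⊙-distribˡ a []      q       = A.refl
  ⊙-distribˡ a (b ∷ p) []      = A.refl
  ⊙-distribˡ a (b ∷ p) (d ∷ q) = ∷-cong (R.distribˡ a b d) (⊙-distribˡ a p q)

  ⊙-distribʳ : ∀ p a b → (a R.+ b) ⊙ p ≋ (a ⊙ p) ⊕ (b ⊙ p)
  ⊙-distribʳ []      a b = A.refl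
  ⊙-distribʳ (d ∷ p) a b = ∷-cong (R.distribʳ d a b) (⊙-distribʳ p a b)

  ⊙-assoc : ∀ a b p → (a R.* b) ⊙ p ≋ a ⊙ (b ⊙ p)
  ⊙-assoc a b []      = A.refl
  ⊙-assoc a b (d ∷ p) = ∷-cong (R.*-assoc a b d) (⊙-assoc a b p)

  ⊙-identity : ∀ p → 1# ⊙ p ≋ p
  ⊙-identity []      = A.refl
  ⊙-identity (a ∷ p) = ∷-cong (R.*-identityˡ a) (⊙-identity p)

  ⊙-zero : ∀ p → 0# ⊙ p ≋ []
  ⊙-zero p = pointwise λ n → R.trans (coeff-⊙ 0# p n) (R.zeroˡ _)

  ⊗-zeroʳ : ∀ p → p ⊗ [] ≋ []
  ⊗-zeroʳ []      = A.refl
  ⊗-zeroʳ (a ∷ p) = A.trans (∷-cong R.refl (⊗-zeroʳ p)) 0∷[]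

  ⊗-∷ : ∀ p b q → p ⊗ (b ∷ q) ≋ (b ⊙ p) ⊕ (0# ∷ (p ⊗ q))
  ⊗-∷ []      b q = A.sym 0∷[]
  ⊗-∷ (a ∷ p) b q = ∷-cong (R.+-congʳ (R.*-comm a b))
    (A.trans (A.∙-congˡ {x = a ⊙ q} (⊗-∷ p b q))
             (x∙yz≈y∙xz (a ⊙ q) (b ⊙ p) (0# ∷ (p ⊗ q))))

  ⊗-comm : ∀ p q → p ⊗ q ≋ q ⊗ p
  ⊗-comm []      q = A.sym (⊗-zeroʳ q)
  ⊗-comm (a ∷ p) q = A.trans
    (A.∙-congˡ {x = a ⊙ q} (∷-cong R.refl (⊗-comm p q))) (A.sym (⊗-∷ q a p))

  ⊗-congˡ : ∀ p {q q′} → q ≋ q′ → p ⊗ q ≋ p ⊗ q′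
  ⊗-congˡ []      e = A.refl
  ⊗-congˡ (a ∷ p) e = ⊕-cong (⊙-cong R.refl e) (∷-cong R.refl (⊗-congˡ p e))

  ⊗-cong : ∀ {p p′ q q′} → p ≋ p′ → q ≋ q′ → p ⊗ q ≋ p′ ⊗ q′
  ⊗-cong {p} {p′} {q} {q′} e f = begin
    p ⊗ q    ≈⟨ ⊗-congˡ p f ⟩
    p ⊗ q′   ≈⟨ ⊗-comm p q′ ⟩
    q′ ⊗ p   ≈⟨ ⊗-congˡ q′ e ⟩
    q′ ⊗ p′  ≈⟨ ⊗-comm q′ p′ ⟩
    p′ ⊗ q′  ∎

  ⊗-distribʳ : ∀ r p q → (p ⊕ q) ⊗ r ≋ (p ⊗ r) ⊕ (q ⊗ r)
  ⊗-distribʳ r []      q       = A.refl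
  ⊗-distribʳ r (a ∷ p) []      = A.sym (⊕-identityʳ _)
  ⊗-distribʳ r (a ∷ p) (b ∷ q) = begin
    ((a R.+ b) ⊙ r) ⊕ (0# ∷ ((p ⊕ q) ⊗ r))
      ≈⟨ ⊕-cong (⊙-distribʳ r a b)
           (A.trans (∷-cong R.refl (⊗-distribʳ r p q)) (0∷-⊕ (p ⊗ r) (q ⊗ r))) ⟩
    ((a ⊙ r) ⊕ (b ⊙ r)) ⊕ ((0# ∷ (p ⊗ r)) ⊕ (0# ∷ (q ⊗ r)))
      ≈⟨ interchange (a ⊙ r) (b ⊙ r) (0# ∷ (p ⊗ r)) (0# ∷ (q ⊗ r)) ⟩
    ((a ⊙ r) ⊕ (0# ∷ (p ⊗ r))) ⊕ ((b ⊙ r) ⊕ (0# ∷ (q ⊗ r))) ∎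

  ⊗-distribˡ : ∀ r p q → r ⊗ (p ⊕ q) ≋ (r ⊗ p) ⊕ (r ⊗ q)
  ⊗-distribˡ r p q = begin
    r ⊗ (p ⊕ q)          ≈⟨ ⊗-comm r (p ⊕ q) ⟩
    (p ⊕ q) ⊗ r          ≈⟨ ⊗-distribʳ r p q ⟩
    (p ⊗ r) ⊕ (q ⊗ r)    ≈⟨ ⊕-cong (⊗-comm p r) (⊗-comm q r) ⟩
    (r ⊗ p) ⊕ (r ⊗ q)    ∎

  0∷-⊗ : ∀ p q → (0# ∷ p) ⊗ q ≋ 0# ∷ (p ⊗ q)
  0∷-⊗ p q = A.∙-congʳ (⊙-zero q)

  ⊙-⊗ : ∀ a q r → (a ⊙ q) ⊗ r ≋ a ⊙ (q ⊗ r)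
  ⊙-⊗ a []      r = A.refl
  ⊙-⊗ a (b ∷ q) r = begin
    ((a R.* b) ⊙ r) ⊕ (0# ∷ ((a ⊙ q) ⊗ r))
      ≈⟨ ⊕-cong (⊙-assoc a b r) (∷-cong (R.sym (R.zeroʳ a)) (⊙-⊗ a q r)) ⟩
    (a ⊙ (b ⊙ r)) ⊕ (a ⊙ (0# ∷ (q ⊗ r)))
      ≈⟨ ⊙-distribˡ a (b ⊙ r) (0# ∷ (q ⊗ r)) ⟨
    a ⊙ ((b ⊙ r) ⊕ (0# ∷ (q ⊗ r))) ∎

  ⊗-assoc : ∀ p q r → (p ⊗ q) ⊗ r ≋ p ⊗ (q ⊗ r)
  ⊗-assoc []      q r = A.refl
  ⊗-assoc (a ∷ p) q r = begin
    ((a ⊙ q) ⊕ (0# ∷ (p ⊗ q))) ⊗ r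
      ≈⟨ ⊗-distribʳ r (a ⊙ q) (0# ∷ (p ⊗ q)) ⟩
    ((a ⊙ q) ⊗ r) ⊕ ((0# ∷ (p ⊗ q)) ⊗ r)
      ≈⟨ ⊕-cong (⊙-⊗ a q r)
           (A.trans (0∷-⊗ (p ⊗ q) r) (∷-cong R.refl (⊗-assoc p q r))) ⟩
    (a ⊙ (q ⊗ r)) ⊕ (0# ∷ (p ⊗ (q ⊗ r))) ∎

  ⊗-identityˡ : ∀ p → 𝟙 ⊗ p ≋ p
  ⊗-identityˡ p = A.trans (⊕-cong (⊙-identity p) 0∷[]) (⊕-identityʳ p)

  ⊗-identityʳ : ∀ p → p ⊗ 𝟙 ≋ p
  ⊗-identityʳ p = A.trans (⊗-comm p 𝟙) (⊗-identityˡ p)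

  ring : CommutativeRing c ℓ
  ring = record
    { Carrier = Poly
    ; _≈_     = _≋_
    ; _+_     = _⊕_
    ; _*_     = _⊗_
    ; -_      = ⊖_
    ; 0#      = []
    ; 1#      = 𝟙
    ; isCommutativeRing = record
      { isRing = record
        { +-isAbelianGroup = ⊕-isAbelianGroup
        ; *-cong           = ⊗-cong
        ; *-assoc          = ⊗-assoc
        ; *-identity       = ⊗-identityˡ , ⊗-identityʳ
        ; distrib          = ⊗-distribˡ , ⊗-distribʳ
        }
      ; *-comm = ⊗-comm
      }
    }

  coeff₀-⊗ : ∀ p q → coeff (p ⊗ q) 0 ≈ coeff p 0 R.* coeff q 0
  coeff₀-⊗ []      q = R.sym (R.zeroˡ _)
  coeff₀-⊗ (a ∷ p) q = R.trans (coeff-⊕ (a ⊙ q) (0# ∷ (p ⊗ q)) 0)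
    (R.trans (R.+-identityʳ _) (coeff-⊙ a q 0))

  constant-term-1⇒regular : ∀ p → coeff p 0 ≈ 1# → ∀ q → p ⊗ q ≋ [] → q ≋ []
  constant-term-1⇒regular p p₀≈1 []      e = A.refl
  constant-term-1⇒regular p p₀≈1 (b ∷ q) e =
    A.trans (∷-cong b≈0 (constant-term-1⇒regular p p₀≈1 q pq≋0)) 0∷[]
    where
    b≈0 : b ≈ 0#
    b≈0 = R.trans (R.sym (R.trans (R.*-congʳ p₀≈1) (R.*-identityˡ b)))
      (R.trans (R.sym (coeff₀-⊗ p (b ∷ q))) (at e 0))

    x·pq≋0 : 0# ∷ (p ⊗ q) ≋ []
    x·pq≋0 = begin
      0# ∷ (p ⊗ q)              ≈⟨ A.∙-congʳ (A.trans (⊙-cong b≈0 A.refl) (⊙-zero p)) ⟨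
      (b ⊙ p) ⊕ (0# ∷ (p ⊗ q))  ≈⟨ ⊗-∷ p b q ⟨
      p ⊗ (b ∷ q)               ≈⟨ e ⟩
      []                        ∎

    pq≋0 : p ⊗ q ≋ []
    pq≋0 = pointwise λ n → at x·pq≋0 (suc n)

-- The total ring of fractions: denominators are the non-zero-divisors.
-- Over an integral domain this is the field of fractions.
module Fractions {c ℓ} (R : CommutativeRing c ℓ) where
  private
    open module R = CommutativeRing R
      using (Carrier; 0#; 1#; _≈_; _+_; _*_; -_; _-_)
    open Relation.Binary.Reasoning.Setoid R.setoid
    open Algebra.Solver.Ring.NaturalCoefficients.Default R.commutativeSemiring
      using (solve; _:+_; _:*_; _:=_)
    module RP = Algebra.Properties.Ring R.ring
    module RG = Algebra.Properties.Group R.+-group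

  Regular : Carrier → Set (c ⊔ ℓ)
  Regular d = ∀ x → d * x ≈ 0# → x ≈ 0#

  1-regular : Regular 1#
  1-regular x e = R.trans (R.sym (R.*-identityˡ x)) e

  *-regular : ∀ {d e} → Regular d → Regular e → Regular (d * e)
  *-regular {d} {e} dr er x eq =
    er x (dr (e * x) (R.trans (R.sym (R.*-assoc d e x)) eq))

  cancel : ∀ {d} → Regular d → ∀ {x y} → d * x ≈ d * y → x ≈ y
  cancel {d} dr {x} {y} e = RG.x∙y⁻¹≈ε⇒x≈y x y (dr (x - y)
    (R.trans (RP.x[y-z]≈xy-xz d x y) (RG.x≈y⇒x∙y⁻¹≈ε e)))

  record Fraction : Set (c ⊔ ℓ) where
    constructor fraction
    field
      num     : Carrier
      den     : Carrier
      regular : Regular den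
  open Fraction public

  fromRing : Carrier → Fraction
  fromRing x = fraction x 1# 1-regular

  infix 4 _≃_
  record _≃_ (x y : Fraction) : Set ℓ where
    constructor cross
    field crossed : num x * den y ≈ num y * den x
  open _≃_ public

  infixl 6 _⊕_
  infixl 7 _⊗_

  _⊕_ : Fraction → Fraction → Fraction
  fraction a b br ⊕ fraction c d dr =
    fraction (a * d + c * b) (b * d) (*-regular br dr)

  _⊗_ : Fraction → Fraction → Fraction
  fraction a b br ⊗ fraction c d dr =
    fraction (a * c) (b * d) (*-regular br dr)

  ⊖_ : Fraction → Fraction
  ⊖ fraction a b br = fraction (- a) b br

  ≃-trans : ∀ {x y z} → x ≃ y → y ≃ z → x ≃ z
  ≃-trans {fraction a b _} {fraction c d dr} {fraction e f _} (cross p) (cross q) =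
    cross (cancel dr (begin
      d * (a * f)  ≈⟨ solve 3 (λ a d f → d :* (a :* f) := (a :* d) :* f) R.refl a d f ⟩
      (a * d) * f  ≈⟨ R.*-congʳ p ⟩
      (c * b) * f  ≈⟨ solve 3 (λ b c f → (c :* b) :* f := (c :* f) :* b) R.refl b c f ⟩
      (c * f) * b  ≈⟨ R.*-congʳ q ⟩
      (e * d) * b  ≈⟨ solve 3 (λ b d e → (e :* d) :* b := d :* (e :* b)) R.refl b d e ⟩
      d * (e * b)  ∎))

  ≃-isEquivalence : IsEquivalence _≃_
  ≃-isEquivalence = record
    { refl  = cross R.refl
    ; sym   = λ (cross p) → cross (R.sym p)
    ; trans = ≃-trans
    }

  ⊕-cong : ∀ {x x′ y y′} → x ≃ x′ → y ≃ y′ → x ⊕ y ≃ x′ ⊕ y′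
  ⊕-cong {fraction a b _} {fraction a′ b′ _} {fraction c d _} {fraction c′ d′ _}
         (cross p) (cross q) = cross (begin
    (a * d + c * b) * (b′ * d′)
      ≈⟨ solve 6 (λ a b b′ c d d′ → (a :* d :+ c :* b) :* (b′ :* d′)
           := (a :* b′) :* (d :* d′) :+ (c :* d′) :* (b :* b′)) R.refl a b b′ c d d′ ⟩
    (a * b′) * (d * d′) + (c * d′) * (b * b′)
      ≈⟨ R.+-cong (R.*-congʳ p) (R.*-congʳ q) ⟩
    (a′ * b) * (d * d′) + (c′ * d) * (b * b′)
      ≈⟨ solve 6 (λ a′ b b′ c′ d d′ → (a′ :* b) :* (d :* d′) :+ (c′ :* d) :* (b :* b′)
           := (a′ :* d′ :+ c′ :* b′) :* (b :* d)) R.refl a′ b b′ c′ d d′ ⟩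
    (a′ * d′ + c′ * b′) * (b * d) ∎)

  ⊗-cong : ∀ {x x′ y y′} → x ≃ x′ → y ≃ y′ → x ⊗ y ≃ x′ ⊗ y′
  ⊗-cong {fraction a b _} {fraction a′ b′ _} {fraction c d _} {fraction c′ d′ _}
         (cross p) (cross q) = cross (begin
    (a * c) * (b′ * d′)
      ≈⟨ solve 4 (λ a c b′ d′ → (a :* c) :* (b′ :* d′) := (a :* b′) :* (c :* d′))
           R.refl a c b′ d′ ⟩
    (a * b′) * (c * d′)  ≈⟨ R.*-cong p q ⟩
    (a′ * b) * (c′ * d)
      ≈⟨ solve 4 (λ a c b′ d′ → (a :* c) :* (b′ :* d′) := (a :* b′) :* (c :* d′))
           R.refl a′ b c′ d ⟩
    (a′ * c′) * (b * d) ∎)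

  ⊖-cong : ∀ {x y} → x ≃ y → ⊖ x ≃ ⊖ y
  ⊖-cong {fraction a b _} {fraction c d _} (cross p) = cross (begin
    - a * d    ≈⟨ RP.-‿distribˡ-* a d ⟨
    - (a * d)  ≈⟨ R.-‿cong p ⟩
    - (c * b)  ≈⟨ RP.-‿distribˡ-* c b ⟩
    - c * b    ∎)

  ⊕-assoc : ∀ x y z → (x ⊕ y) ⊕ z ≃ x ⊕ (y ⊕ z)
  ⊕-assoc (fraction a b _) (fraction c d _) (fraction e f _) = cross
    (solve 6 (λ a b c d e f →
        ((a :* d :+ c :* b) :* f :+ e :* (b :* d)) :* (b :* (d :* f))
        := (a :* (d :* f) :+ (c :* f :+ e :* d) :* b) :* (b :* d :* f))
      R.refl a b c d e f)

  ⊕-comm : ∀ x y → x ⊕ y ≃ y ⊕ x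
  ⊕-comm (fraction a b _) (fraction c d _) = cross
    (R.*-cong (R.+-comm (a * d) (c * b)) (R.*-comm d b))

  ⊕-identityˡ : ∀ x → fromRing 0# ⊕ x ≃ x
  ⊕-identityˡ (fraction a b _) = cross (begin
    (0# * b + a * 1#) * b  ≈⟨ R.*-congʳ (R.+-cong (R.zeroˡ b) (R.*-identityʳ a)) ⟩
    (0# + a) * b           ≈⟨ R.*-cong (R.+-identityˡ a) (R.sym (R.*-identityˡ b)) ⟩
    a * (1# * b)           ∎)

  ⊕-inverseˡ : ∀ x → (⊖ x) ⊕ x ≃ fromRing 0#
  ⊕-inverseˡ (fraction a b _) = cross (begin
    (- a * b + a * b) * 1#  ≈⟨ R.*-identityʳ _ ⟩
    - a * b + a * b         ≈⟨ R.distribʳ b (- a) a ⟨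
    (- a + a) * b           ≈⟨ R.*-congʳ (R.-‿inverseˡ a) ⟩
    0# * b                  ≈⟨ R.zeroˡ b ⟩
    0#                      ≈⟨ R.zeroˡ (b * b) ⟨
    0# * (b * b)            ∎)

  ⊗-assoc : ∀ x y z → (x ⊗ y) ⊗ z ≃ x ⊗ (y ⊗ z)
  ⊗-assoc (fraction a b _) (fraction c d _) (fraction e f _) = cross
    (R.*-cong (R.*-assoc a c e) (R.sym (R.*-assoc b d f)))

  ⊗-comm : ∀ x y → x ⊗ y ≃ y ⊗ x
  ⊗-comm (fraction a b _) (fraction c d _) = cross
    (R.*-cong (R.*-comm a c) (R.*-comm d b))

  ⊗-identityˡ : ∀ x → fromRing 1# ⊗ x ≃ x
  ⊗-identityˡ (fraction a b _) = cross
    (R.trans (R.*-congʳ (R.*-identityˡ a)) (R.*-congˡ (R.sym (R.*-identityˡ b))))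

  ⊗-distribˡ : ∀ x y z → x ⊗ (y ⊕ z) ≃ (x ⊗ y) ⊕ (x ⊗ z)
  ⊗-distribˡ (fraction a b _) (fraction c d _) (fraction e f _) = cross
    (solve 6 (λ a b c d e f →
        (a :* (c :* f :+ e :* d)) :* ((b :* d) :* (b :* f))
        := ((a :* c) :* (b :* f) :+ (a :* e) :* (b :* d)) :* (b :* (d :* f)))
      R.refl a b c d e f)

  ring : CommutativeRing (c ⊔ ℓ) ℓ
  ring = record
    { Carrier = Fraction
    ; _≈_     = _≃_
    ; _+_     = _⊕_
    ; _*_     = _⊗_
    ; -_      = ⊖_
    ; 0#      = fromRing 0#
    ; 1#      = fromRing 1#
    ; isCommutativeRing = record
      { isRing = record
        { +-isAbelianGroup = record
          { isGroup = record
            { isMonoid = record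
              { isSemigroup = record
                { isMagma = record
                  { isEquivalence = ≃-isEquivalence
                  ; ∙-cong        = ⊕-cong
                  }
                ; assoc = ⊕-assoc
                }
              ; identity = ⊕-identityˡ
                         , λ x → ≃-trans (⊕-comm x (fromRing 0#)) (⊕-identityˡ x)
              }
            ; inverse = ⊕-inverseˡ , λ x → ≃-trans (⊕-comm x (⊖ x)) (⊕-inverseˡ x)
            ; ⁻¹-cong = ⊖-cong
            }
          ; comm = ⊕-comm
          }
        ; *-cong     = ⊗-cong
        ; *-assoc    = ⊗-assoc
        ; *-identity = ⊗-identityˡ
                     , λ x → ≃-trans (⊗-comm x (fromRing 1#)) (⊗-identityˡ x)
        ; distrib    = ⊗-distribˡ
                     , λ x y z → ≃-trans (⊗-comm (y ⊕ z) x)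
                         (≃-trans (⊗-distribˡ x y z) (⊕-cong (⊗-comm x y) (⊗-comm x z)))
        }
      ; *-comm = ⊗-comm
      }
    }

module Tridiagonal {c ℓ} (R : CommutativeRing c ℓ) where

  -- R[√X][√q]; the squares X and q are algebraically independent over R.
  P : CommutativeRing c ℓ
  P = Polynomial.ring (Polynomial.ring R)

  open Operations P using (det) public
  open Operations P hiding (det)
  private
    module R[√X]     = Polynomial R
    module R[√X][√q] = Polynomial (Polynomial.ring R)
  open Fractions P public using (Fraction; fraction; fromRing; Regular)
  open Fractions P using (1-regular; *-regular)

  K : CommutativeRing (c ⊔ ℓ) ℓ
  K = Fractions.ring P

  open Operations K public using () renaming (_≈_ to _≈ᴷ_; sum to sumᴷ)

  √X √q X q : Carrier
  √X = R[√X][√q].constant R[√X].indeterminate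
  √q = R[√X][√q].indeterminate
  X  = √X ^ 2
  q  = √q ^ 2

  -- Indices i and j start at 1.  The truncated i ∸ 2 is harmless, as the
  -- subdiagonal requires i ≥ 2.
  entry : ℕ → ℕ → Carrier
  entry i j =
    if i ≡ᵇ j     then 1#                  else
    if suc i ≡ᵇ j then √X * √q ^ (i ∸ 1)   else
    if i ≡ᵇ suc j then √X * √q ^ (i ∸ 2)   else
    0#

  M : ∀ n → Fin n → Fin n → Carrier
  M n i j = entry (suc (toℕ i)) (suc (toℕ j))

  -- The product has the a factors 1 - q^m for m = n-a, n-a-1, …, n-2a+1;
  -- no subtraction truncates when 2a ≤ n.
  numerator : ℕ → ℕ → Carrier
  numerator n a =
    (- 1#) ^ a * X ^ a * q ^ (a · (a ∸ 1))
      * product {a} λ i → 1# - q ^ (n ∸ a ∸ toℕ i)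

  denominator : ℕ → Carrier
  denominator a = product {a} λ i → 1# - q ^ suc (toℕ i)

  1-q^k-regular : ∀ k → Regular (1# - q ^ suc k)
  1-q^k-regular k = R[√X][√q].constant-term-1⇒regular (1# - q ^ suc k) const≈1
    where
    module S  = CommutativeRing R[√X].ring
    module SG = Algebra.Properties.Group S.+-group
    open R[√X][√q] using (coeff; coeff-⊕; coeff-⊖; coeff₀-⊗)

    q₀≈0 : coeff q 0 S.≈ S.0#
    q₀≈0 = S.trans (coeff₀-⊗ √q (√q ^ 1)) (S.zeroˡ (coeff (√q ^ 1) 0))

    qᵏ₀≈0 : coeff (q ^ suc k) 0 S.≈ S.0#
    qᵏ₀≈0 = S.trans (coeff₀-⊗ q (q ^ k))
      (S.trans (S.*-congʳ {coeff (q ^ k) 0} q₀≈0) (S.zeroˡ (coeff (q ^ k) 0)))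

    const≈1 : coeff (1# - q ^ suc k) 0 S.≈ S.1#
    const≈1 = S.trans (coeff-⊕ 1# (- (q ^ suc k)) 0)
      (S.trans
        (S.+-congˡ {S.1#} (S.trans (coeff-⊖ (q ^ suc k) 0)
          (S.trans (S.-‿cong qᵏ₀≈0) SG.ε⁻¹≈ε)))
        (S.+-identityʳ S.1#))

  product-regular : ∀ {n} (v : Vector Carrier n) →
    (∀ i → Regular (v i)) → Regular (product v)
  product-regular {zero}  v r = 1-regular
  product-regular {suc n} v r =
    *-regular {v zero} {product {n} (λ i → v (suc i))}
      (r zero) (product-regular (λ i → v (suc i)) (λ i → r (suc i)))

  denominator-regular : ∀ a → Regular (denominator a)
  denominator-regular a = product-regular {a} _ (λ i → 1-q^k-regular (toℕ i))

  summand : ℕ → ℕ → Fraction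
  summand n a = fraction (numerator n a) (denominator a) (denominator-regular a)

{-# OPTIONS --safe #-}

-- Expanding along the first row, det M(n) is the continuant of the products
-- X q^i of opposite off-diagonal entries.  Removing the first row and column
-- replaces X by Xq, so the continuants satisfy
--   C(X, n+2) = C(Xq, n+1) - X C(Xq², n).
-- The sums Σ (-1)^a X^a q^(a(a-1)) [n-a choose a] satisfy the same recurrence,
-- term by term, by the q-Pascal rule; and [m choose a], defined by that rule,
-- times (1-q)⋯(1-q^a) is (1-q^m)⋯(1-q^(m-a+1)).
module Submission where

open import Defs
open import Algebra.Bundles using (CommutativeRing)
open import Data.Bool.Base using (if_then_else_)
open import Data.Fin.Base using (Fin; zero; suc; toℕ; punchIn)
open import Data.Nat.Base
  using (ℕ; zero; suc; 2+; _∸_; _≡ᵇ_; _≤_; _<_; _≥_; z≤n; s≤s; ⌊_/2⌋)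
  renaming (_+_ to _∔_; _*_ to _·_)
open import Data.Nat.Properties
  using (_≤?_; ≰⇒>; ≤-refl; ≤-trans; n≤1+n; m+[n∸m]≡n; +-∸-assoc; m≤n⇒m∸n≡0;
         0∸n≡0; ⌊n/2⌋-mono)
open import Data.Nat.Solver using (module +-*-Solver)
open import Function.Base using (_∘_)
open import Relation.Binary.PropositionalEquality.Core as ≡ using (_≡_)
open import Relation.Nullary.Decidable.Core using (yes; no)

import Algebra.Properties.CommutativeMonoid.Sum
import Algebra.Properties.CommutativeSemiring.Exp
import Algebra.Properties.Ring
import Algebra.Properties.Semiring.Exp
import Algebra.Properties.Semiring.Sum
import Algebra.Solver.Ring.NaturalCoefficients.Default
import Relation.Binary.Reasoning.Setoid

-- Determinants of tridiagonal matrices by first-row expansion.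

module Determinant {c ℓ} (R : CommutativeRing c ℓ) where
  open Operations R
  open Algebra.Properties.CommutativeMonoid.Sum +-commutativeMonoid
    using (sum-cong-≋; sum-replicate-zero)
  open Algebra.Properties.Ring ring using (-1*x≈-x; -‿distribˡ-*)
  open Relation.Binary.Reasoning.Setoid setoid

  sum-zero : ∀ {n} (v : Fin n → Carrier) → (∀ i → v i ≈ 0#) → sum v ≈ 0#
  sum-zero {n} v v≈0 = trans (sum-cong-≋ v≈0) (sum-replicate-zero n)

  minor : ∀ {n} → (Fin (suc n) → Fin (suc n) → Carrier) → Fin (suc n) →
    Fin n → Fin n → Carrier
  minor A j r s = A (suc r) (punchIn j s)

  det-cong : ∀ {n} {A B : Fin n → Fin n → Carrier} →
    (∀ i j → A i j ≈ B i j) → det A ≈ det B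
  det-cong {zero}  e = refl
  det-cong {suc n} e = sum-cong-≋ λ j →
    *-cong (*-congˡ {(- 1#) ^ toℕ j} (e zero j)) (det-cong λ r s → e (suc r) (punchIn j s))

  -- The first term contains a zero entry. Deleting a later column keeps the zero column in the
  -- minor, so the other terms vanish by induction.
  det-zero-column : ∀ {n} (A : Fin (suc n) → Fin (suc n) → Carrier) →
    (∀ i → A i zero ≈ 0#) → det A ≈ 0#
  det-zero-column A e = sum-zero _ λ j → term A e j
    where
    -- Quantified over the size again, so that `suc j` can force the minor to be nonempty.
    term : ∀ {n} (A : Fin (suc n) → Fin (suc n) → Carrier) →
      (∀ i → A i zero ≈ 0#) → ∀ j →
      (- 1#) ^ toℕ j * A zero j * det (minor A j) ≈ 0#
    term A e zero = trans (*-congʳ (trans (*-congˡ (e zero)) (zeroʳ _))) (zeroˡ _)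
    term {suc n} A e (suc j) = trans
      (*-congˡ (det-zero-column (minor A (suc j)) λ i → e (suc i))) (zeroʳ _)

  -- Deleting row zero and a later column leaves a minor whose first column is zero, so only the
  -- corner term survives.
  det-first-column : ∀ {n} (A : Fin (suc n) → Fin (suc n) → Carrier) →
    (∀ i → A (suc i) zero ≈ 0#) →
    det A ≈ A zero zero * det (λ r s → A (suc r) (suc s))
  det-first-column {n} A e = begin
    1# * A zero zero * det (minor A zero) + sum rest
      ≈⟨ +-cong (*-congʳ (*-identityˡ _)) (sum-zero rest (rest≈0 A e)) ⟩
    A zero zero * det (minor A zero) + 0#
      ≈⟨ +-identityʳ _ ⟩
    A zero zero * det (minor A zero) ∎
    where
    rest : Fin n → Carrier
    rest j = (- 1#) ^ toℕ (suc j) * A zero (suc j) * det (minor A (suc j))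

    rest≈0 : ∀ {n} (A : Fin (suc n) → Fin (suc n) → Carrier) →
      (∀ i → A (suc i) zero ≈ 0#) → ∀ j →
      (- 1#) ^ toℕ (suc j) * A zero (suc j) * det (minor A (suc j)) ≈ 0#
    rest≈0 {suc n} A e j =
      trans (*-congˡ (det-zero-column (minor A (suc j)) e)) (zeroʳ _)

  -- Recursion on both indices makes deleting the first row and column a shift of `u` and `l` that
  -- holds by computation.
  tridiagonal : (u l : ℕ → Carrier) → ℕ → ℕ → Carrier
  tridiagonal u l zero          zero          = 1#
  tridiagonal u l zero          (suc zero)    = u 0
  tridiagonal u l zero          (suc (suc j)) = 0#
  tridiagonal u l (suc i)       (suc j)       = tridiagonal (u ∘ suc) (l ∘ suc) i j
  tridiagonal u l (suc zero)    zero          = l 0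
  tridiagonal u l (suc (suc i)) zero          = 0#

  -- The subdiagonal branch is reached only for i ≥ 1.
  if-tridiagonal : ∀ u l i j →
    (if i ≡ᵇ j     then 1#      else
     if suc i ≡ᵇ j then u i     else
     if i ≡ᵇ suc j then l (i ∸ 1) else
     0#) ≡ tridiagonal u l i j
  if-tridiagonal u l zero          zero          = ≡.refl
  if-tridiagonal u l zero          (suc zero)    = ≡.refl
  if-tridiagonal u l zero          (suc (suc j)) = ≡.refl
  if-tridiagonal u l (suc zero)    zero          = ≡.refl
  if-tridiagonal u l (suc (suc i)) zero          = ≡.refl
  if-tridiagonal u l (suc zero)    (suc j)       =
    if-tridiagonal (u ∘ suc) (l ∘ suc) zero j
  if-tridiagonal u l (suc (suc i)) (suc j)       =
    if-tridiagonal (u ∘ suc) (l ∘ suc) (suc i) j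

  continuant : (ℕ → Carrier) → ℕ → Carrier
  continuant w zero          = 1#
  continuant w (suc zero)    = 1#
  continuant w (suc (suc n)) =
    continuant (w ∘ suc) (suc n) - w 0 * continuant (w ∘ 2+) n

  -- Only two entries of the first row can be nonzero. The second minor has `l 0` on top of a first
  -- column that is zero below, so `det-first-column` turns the second term into `- (u 0 * l 0)`
  -- times the continuant shifted twice.
  det-tridiagonal : ∀ u l n →
    det {n} (λ i j → tridiagonal u l (toℕ i) (toℕ j)) ≈ continuant (λ i → u i * l i) n
  det-tridiagonal u l zero          = refl
  det-tridiagonal u l (suc zero)    =
    trans (+-identityʳ _) (trans (*-identityʳ _) (*-identityˡ 1#))
  det-tridiagonal u l (suc (suc n)) = begin
    1# * 1# * det (minor A zero)
      + ((- 1#) * 1# * u 0 * det (minor A (suc zero)) + sum rest)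
      ≈⟨ +-cong (trans (*-congʳ (*-identityˡ 1#)) (*-identityˡ _))
           (trans (+-congˡ (sum-zero rest λ j → trans (*-congʳ (zeroʳ _)) (zeroˡ _)))
                  (+-identityʳ _)) ⟩
    det (minor A zero) + (- 1#) * 1# * u 0 * det (minor A (suc zero))
      ≈⟨ +-cong (det-tridiagonal (u ∘ suc) (l ∘ suc) (suc n)) (begin
           (- 1#) * 1# * u 0 * det (minor A (suc zero))
             ≈⟨ *-cong (trans (*-congʳ (*-identityʳ _)) (-1*x≈-x _))
                  (trans (det-first-column (minor A (suc zero)) λ i → refl)
                    (*-congˡ (det-tridiagonal (u ∘ 2+) (l ∘ 2+) n))) ⟩
           - u 0 * (l 0 * C)    ≈⟨ -‿distribˡ-* _ _ ⟨
           - (u 0 * (l 0 * C))  ≈⟨ -‿cong (*-assoc _ _ _) ⟨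
           - (u 0 * l 0 * C)    ∎) ⟩
    continuant (λ i → u (suc i) * l (suc i)) (suc n) - u 0 * l 0 * C ∎
    where
    A : Fin (suc (suc n)) → Fin (suc (suc n)) → Carrier
    A i j = tridiagonal u l (toℕ i) (toℕ j)

    C : Carrier
    C = continuant (λ i → u (suc (suc i)) * l (suc (suc i))) n

    rest : Fin n → Carrier
    rest j = (- 1#) ^ toℕ (suc (suc j)) * 0# * det (minor A (suc (suc j)))

-- Gaussian binomials and their product formula.

module GaussianBinomial {c ℓ} (R : CommutativeRing c ℓ)
  (q : CommutativeRing.Carrier R) where
  open Operations R
  open Algebra.Properties.Semiring.Exp semiring using (^-homo-*)
  open Algebra.Properties.Ring ring using (x[y-z]≈xy-xz)
  open Algebra.Solver.Ring.NaturalCoefficients.Default commutativeSemiring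
    using (solve; _:+_; _:*_; _:=_)
  open Relation.Binary.Reasoning.Setoid setoid

  -- Of the two q-Pascal rules, this one has a power of `q` depending on the lower index alone, so
  -- the power can be absorbed by rescaling `y` in `coefficient`.
  gauss : ℕ → ℕ → Carrier
  gauss m       zero    = 1#
  gauss zero    (suc a) = 0#
  gauss (suc m) (suc a) = q ^ suc a * gauss m (suc a) + gauss m a

  gauss-zero : ∀ {m a} → m < a → gauss m a ≈ 0#
  gauss-zero {zero}  {suc a} m<a       = refl
  gauss-zero {suc m} {suc a} (s≤s m<a) = begin
    q ^ suc a * gauss m (suc a) + gauss m a
      ≈⟨ +-cong (*-congˡ (gauss-zero (≤-trans m<a (n≤1+n a)))) (gauss-zero m<a) ⟩
    q ^ suc a * 0# + 0#  ≈⟨ +-identityʳ _ ⟩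
    q ^ suc a * 0#       ≈⟨ zeroʳ _ ⟩
    0#                   ∎

  product-snoc : ∀ (f : ℕ → Carrier) n →
    product {suc n} (λ i → f (toℕ i)) ≈ product {n} (λ i → f (toℕ i)) * f n
  product-snoc f zero    = *-comm _ _
  product-snoc f (suc n) =
    trans (*-congˡ (product-snoc (f ∘ suc) n)) (sym (*-assoc _ _ _))

  falling : ℕ → ℕ → Carrier
  falling m a = product {a} λ i → 1# - q ^ (m ∸ toℕ i)

  rising : ℕ → Carrier
  rising a = product {a} λ i → 1# - q ^ suc (toℕ i)

  -- The factor at index `m` is `1# - q ^ 0`.
  falling-zero : ∀ {m a} → m < a → falling m a ≈ 0#
  falling-zero {zero}  {suc a} m<a       = trans (*-congʳ (-‿inverseʳ 1#)) (zeroˡ _)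
  falling-zero {suc m} {suc a} (s≤s m<a) = trans (*-congˡ (falling-zero m<a)) (zeroʳ _)

  -- If `a ≤ m` the exponents add up to `suc m`. Otherwise truncated subtraction breaks this, but
  -- `falling m a` is zero.
  falling-q^ : ∀ m a → falling m a * (1# - q ^ suc a * q ^ (m ∸ a)) ≈
    falling m a * (1# - q ^ suc m)
  falling-q^ m a with a ≤? m
  ... | yes a≤m = *-congˡ (+-congˡ (-‿cong (begin
    q ^ suc a * q ^ (m ∸ a)  ≈⟨ ^-homo-* q (suc a) (m ∸ a) ⟨
    q ^ (suc a ∔ (m ∸ a))    ≡⟨ ≡.cong (λ k → q ^ suc k) (m+[n∸m]≡n a≤m) ⟩
    q ^ suc m                ∎)))
  ... | no a≰m = trans (vanish _) (sym (vanish _))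
    where
    vanish : ∀ x → falling m a * x ≈ 0#
    vanish x = trans (*-congʳ (falling-zero (≰⇒> a≰m))) (zeroˡ x)

  -- The quotient formula without division. In the inductive step both Pascal terms contain `f`, and
  -- the remaining factor `p * (1# - r) + (1# - p)` collapses to `1# - p * r`.
  gauss-rising : ∀ m a → gauss m a * rising a ≈ falling m a
  gauss-rising m       zero    = *-identityˡ 1#
  gauss-rising zero    (suc a) = trans (zeroˡ _) (sym (falling-zero (s≤s (z≤n {a}))))
  gauss-rising (suc m) (suc a) = begin
    (p * gauss m (suc a) + gauss m a) * rising (suc a)
      ≈⟨ solve 4 (λ p g h d → (p :* g :+ h) :* d := p :* (g :* d) :+ h :* d)
           refl p (gauss m (suc a)) (gauss m a) (rising (suc a)) ⟩
    p * (gauss m (suc a) * rising (suc a)) + gauss m a * rising (suc a)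
      ≈⟨ +-cong
           (*-congˡ (trans (gauss-rising m (suc a))
             (product-snoc (λ i → 1# - q ^ (m ∸ i)) a)))
           (trans (*-congˡ (product-snoc (λ i → 1# - q ^ suc i) a))
             (trans (sym (*-assoc _ _ _)) (*-congʳ (gauss-rising m a)))) ⟩
    p * (f * (1# - r)) + f * (1# - p)
      ≈⟨ solve 4 (λ p f x y → p :* (f :* x) :+ f :* y := f :* (p :* x :+ y))
           refl p f (1# - r) (1# - p) ⟩
    f * (p * (1# - r) + (1# - p))
      ≈⟨ *-congˡ (begin
           p * (1# - r) + (1# - p)
             ≈⟨ +-congʳ (trans (x[y-z]≈xy-xz p 1# r) (+-congʳ (*-identityʳ p))) ⟩
           p - p * r + (1# - p)
             ≈⟨ solve 4 (λ p x o y → (p :+ x) :+ (o :+ y) := (o :+ x) :+ (p :+ y))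
                  refl p (- (p * r)) 1# (- p) ⟩
           1# - p * r + (p - p)
             ≈⟨ trans (+-congˡ (-‿inverseʳ p)) (+-identityʳ _) ⟩
           1# - p * r ∎) ⟩
    f * (1# - p * r)       ≈⟨ falling-q^ m a ⟩
    f * (1# - q ^ suc m)   ≈⟨ *-comm _ _ ⟩
    (1# - q ^ suc m) * f   ∎
    where
    p r f : Carrier
    p = q ^ suc a
    r = q ^ (m ∸ a)
    f = falling m a

-- The recurrence shared by the continuant and the q-binomial sum.

module Expansion {c ℓ} (R : CommutativeRing c ℓ)
  (q : CommutativeRing.Carrier R) where
  open Operations R
  open Determinant R using (continuant; sum-zero)
  open GaussianBinomial R q
  open Algebra.Properties.Semiring.Exp semiring using (^-homo-*)
  open Algebra.Properties.CommutativeSemiring.Exp commutativeSemiring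
    using (^-distrib-*)
  open Algebra.Properties.CommutativeMonoid.Sum +-commutativeMonoid
    using (sum-cong-≋; ∑-distrib-+)
  open Algebra.Properties.Semiring.Sum semiring using (*-distribˡ-sum)
  open Algebra.Properties.Ring ring using (-1*x≈-x; -‿distribˡ-*)
  open Algebra.Solver.Ring.NaturalCoefficients.Default commutativeSemiring
    using (solve; _:+_; _:*_; _:=_)
  open Relation.Binary.Reasoning.Setoid setoid

  coefficient : Carrier → ℕ → Carrier
  coefficient y a = (- 1#) ^ a * y ^ a * q ^ (a · (a ∸ 1))

  term : Carrier → ℕ → ℕ → Carrier
  term y n a = coefficient y a * gauss (n ∸ a) a

  coefficient-q : ∀ y a → coefficient (y * q) a ≈ q ^ a * coefficient y a
  coefficient-q y a = trans (*-congʳ (*-congˡ (^-distrib-* y q a)))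
    (solve 4 (λ s t u v → s :* (t :* u) :* v := u :* (s :* t :* v))
      refl ((- 1#) ^ a) (y ^ a) (q ^ a) (q ^ (a · (a ∸ 1))))

  -- Raising the index adds `2a` to the exponent `a(a-1)` of `q`; the two extra factors `q ^ a` are
  -- absorbed into `y * q * q`.
  coefficient-suc : ∀ y a →
    coefficient y (suc a) ≈ - y * coefficient (y * q * q) a
  coefficient-suc y a = begin
    - 1# * s * (y * t) * q ^ (suc a · a)
      ≈⟨ *-congˡ (trans (reflexive (≡.cong (q ^_) (exponent a)))
           (trans (^-homo-* q a _) (*-congˡ (^-homo-* q a _)))) ⟩
    - 1# * s * (y * t) * (u * (u * v))
      ≈⟨ solve 6 (λ n s y t u v → n :* s :* (y :* t) :* (u :* (u :* v)) :=
           n :* y :* (u :* (u :* (s :* t :* v)))) refl (- 1#) s y t u v ⟩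
    - 1# * y * (u * (u * coefficient y a))
      ≈⟨ *-cong (-1*x≈-x y) (trans (*-congˡ (sym (coefficient-q y a)))
           (sym (coefficient-q (y * q) a))) ⟩
    - y * coefficient (y * q * q) a ∎
    where
    s t u v : Carrier
    s = (- 1#) ^ a
    t = y ^ a
    u = q ^ a
    v = q ^ (a · (a ∸ 1))

    exponent : ∀ a → suc a · a ≡ a ∔ (a ∔ a · (a ∸ 1))
    -- Here `a ∸ 1` truncates, but its factor `a` is zero.
    exponent zero    = ≡.refl
    exponent (suc a) = +-*-Solver.solve 1
      (λ a → (con 2 ⊹ a) ⊛ (con 1 ⊹ a) ⊜
             (con 1 ⊹ a) ⊹ ((con 1 ⊹ a) ⊹ (con 1 ⊹ a) ⊛ a)) ≡.refl a
      where open +-*-Solver using (con) renaming (_:+_ to _⊹_; _:*_ to _⊛_; _:=_ to _⊜_)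

  -- For `a ≤ n` this is the defining rule at `suc (n ∸ a)`; for larger `a` every upper index
  -- truncates to 0.
  gauss-antidiagonal : ∀ n a → gauss (suc n ∸ a) (suc a) ≈
    q ^ suc a * gauss (n ∸ a) (suc a) + gauss (n ∸ a) a
  gauss-antidiagonal n a with a ≤? n
  ... | yes a≤n rewrite +-∸-assoc 1 a≤n = refl
  -- Matching exposes `a` as a successor, so the last term is not `gauss 0 0`, which would be 1.
  ... | no a≰n with ≰⇒> a≰n
  ... | s≤s {n = b} n≤b
    rewrite m≤n⇒m∸n≡0 n≤b | m≤n⇒m∸n≡0 (≤-trans n≤b (n≤1+n b)) =
    sym (trans (+-identityʳ _) (zeroʳ _))

  -- The q-Pascal rule splits the term: the power of `q` in one part rescales `y` once, and lowering
  -- the index in the other gives `- y` and rescales twice.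
  term-step : ∀ y n a → term y (suc (suc n)) (suc a) ≈
    term (y * q) (suc n) (suc a) + - y * term (y * q * q) n a
  term-step y n a = begin
    c₁ * gauss (suc n ∸ a) (suc a)   ≈⟨ *-congˡ (gauss-antidiagonal n a) ⟩
    c₁ * (p * g + h)
      ≈⟨ solve 4 (λ c p g h → c :* (p :* g :+ h) := p :* c :* g :+ c :* h)
           refl c₁ p g h ⟩
    p * c₁ * g + c₁ * h
      ≈⟨ +-cong (*-congʳ (sym (coefficient-q y (suc a))))
           (trans (*-congʳ (coefficient-suc y a)) (*-assoc _ _ _)) ⟩
    coefficient (y * q) (suc a) * g + - y * (coefficient (y * q * q) a * h) ∎
    where
    c₁ p g h : Carrier
    c₁ = coefficient y (suc a)
    p  = q ^ suc a
    g  = gauss (n ∸ a) (suc a)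
    h  = gauss (n ∸ a) a

  term-0 : ∀ y n → term y n 0 ≈ 1#
  term-0 y n = trans (*-identityʳ _) (trans (*-identityʳ _) (*-identityʳ _))

  expansion : Carrier → ℕ → ℕ → Carrier
  expansion y n N = sum {N} λ a → term y n (toℕ a)

  expansion-≤1 : ∀ y n N → n ≤ 1 → expansion y n (suc N) ≈ 1#
  expansion-≤1 y n N n≤1 = trans
    (+-cong (term-0 y n) (sum-zero {N} _ λ a →
      trans (*-congˡ (vanish n≤1 (toℕ a))) (zeroʳ _)))
    (+-identityʳ 1#)
    where
    vanish : ∀ {n} → n ≤ 1 → ∀ a → gauss (n ∸ suc a) (suc a) ≈ 0#
    vanish z≤n       a = refl
    vanish (s≤s z≤n) a rewrite 0∸n≡0 a = refl

  -- The terms at index 0 are both 1, and `term-step` handles the others. Its second part lowers the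
  -- index, hence `N` terms in the last sum against `suc N` in the others.
  expansion-step : ∀ y n N → expansion y (suc (suc n)) (suc N) ≈
    expansion (y * q) (suc n) (suc N) - y * expansion (y * q * q) n N
  expansion-step y n N = begin
    term y (suc (suc n)) 0 + sum {N} (λ a → term y (suc (suc n)) (suc (toℕ a)))
      ≈⟨ +-cong (trans (term-0 y (suc (suc n))) (sym (term-0 (y * q) (suc n))))
           (trans (sum-cong-≋ {N} λ a → term-step y n (toℕ a))
                  (∑-distrib-+ {N} _ _)) ⟩
    term (y * q) (suc n) 0
      + (sum {N} (λ a → term (y * q) (suc n) (suc (toℕ a)))
        + sum {N} (λ a → - y * term (y * q * q) n (toℕ a)))
      ≈⟨ +-assoc _ _ _ ⟨
    expansion (y * q) (suc n) (suc N) + sum {N} (λ a → - y * term (y * q * q) n (toℕ a))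
      ≈⟨ +-congˡ (trans (sym (*-distribˡ-sum {N} (- y) _)) (sym (-‿distribˡ-* _ _))) ⟩
    expansion (y * q) (suc n) (suc N) - y * expansion (y * q * q) n N ∎

  -- The number N of terms is left free because the two smaller continuants
  -- in the recurrence need the same, not necessarily minimal, upper limit.
  continuant-expansion : ∀ {w y} → (∀ i → w i ≈ y * q ^ i) →
    ∀ n {N} → ⌊ n /2⌋ < N → continuant w n ≈ expansion y n N
  continuant-expansion {y = y} e zero       {suc N} lt = sym (expansion-≤1 y 0 N z≤n)
  continuant-expansion {y = y} e (suc zero) {suc N} lt = sym (expansion-≤1 y 1 N ≤-refl)
  continuant-expansion {w} {y} e (suc (suc n)) {suc N} (s≤s lt) = begin
    continuant (w ∘ suc) (suc n) - w 0 * continuant (w ∘ 2+) n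
      ≈⟨ +-cong
           (continuant-expansion (shift w e) (suc n)
             -- Halving is monotone, so the bound for `suc (suc n)` also serves `suc n`.
             (s≤s (≤-trans (⌊n/2⌋-mono (n≤1+n (suc n))) lt)))
           (-‿cong (*-cong (trans (e 0) (*-identityʳ y))
             (continuant-expansion (shift (w ∘ suc) (shift w e)) n lt))) ⟩
    expansion (y * q) (suc n) (suc N) - y * expansion (y * q * q) n N
      ≈⟨ expansion-step y n N ⟨
    expansion y (suc (suc n)) (suc N) ∎
    where
    shift : ∀ w {y} → (∀ i → w i ≈ y * q ^ i) → ∀ i → w (suc i) ≈ y * q * q ^ i
    shift w e i = trans (e (suc i)) (sym (*-assoc _ _ _))

-- Passing from ring elements to sums of fractions.

module FractionSum {c ℓ} (R : CommutativeRing c ℓ) where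
  private
    module R = Operations R
    module F = Fractions R
    module K = Operations F.ring
  open Algebra.Properties.CommutativeMonoid.Sum K.+-commutativeMonoid
    using (sum-cong-≋)

  fromRing-cong : ∀ {x y} → x R.≈ y → F.fromRing x F.≃ F.fromRing y
  fromRing-cong e = F.cross (R.*-congʳ e)

  fromRing-+ : ∀ x y → F.fromRing (x R.+ y) F.≃ F.fromRing x F.⊕ F.fromRing y
  fromRing-+ x y = F.cross (R.*-cong
    (R.sym (R.+-cong (R.*-identityʳ x) (R.*-identityʳ y))) (R.*-identityˡ R.1#))

  fromRing-sum : ∀ {n} (v : Fin n → R.Carrier) →
    F.fromRing (R.sum v) F.≃ K.sum (F.fromRing ∘ v)
  fromRing-sum {zero}  v = K.refl
  fromRing-sum {suc n} v = K.trans (fromRing-+ (v zero) (R.sum (v ∘ suc)))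
    (K.+-congˡ {F.fromRing (v zero)} (fromRing-sum (v ∘ suc)))

  -- Each fraction equals a ring element, so the sums are compared term by term and no common
  -- denominator is formed.
  sum-fromRing : ∀ {n} (v : Fin n → R.Carrier) (f : Fin n → F.Fraction) →
    (∀ i → v i R.* F.den (f i) R.≈ F.num (f i)) →
    F.fromRing (R.sum v) F.≃ K.sum f
  sum-fromRing v f e = K.trans (fromRing-sum v) (sum-cong-≋ λ i →
    F.cross (R.trans (e i) (R.sym (R.*-identityʳ (F.num (f i))))))

-- Squares of the off-diagonal entries.

module Squares {c ℓ} (R : CommutativeRing c ℓ) where
  open Operations R
  open Algebra.Properties.Semiring.Exp semiring using (^-congˡ)
  open Algebra.Properties.CommutativeSemiring.Exp commutativeSemiring
    using (^-distrib-*)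
  open Algebra.Solver.Ring.NaturalCoefficients.Default commutativeSemiring
    using (solve; _:*_; _:=_)

  x^2≈x*x : ∀ x → x ^ 2 ≈ x * x
  x^2≈x*x x = *-congˡ (*-identityʳ x)

  square-*-^ : ∀ x t i → x * t ^ i * (x * t ^ i) ≈ x ^ 2 * (t ^ 2) ^ i
  square-*-^ x t i = trans
    (solve 2 (λ x u → x :* u :* (x :* u) := x :* x :* (u :* u)) refl x (t ^ i))
    (sym (*-cong (x^2≈x*x x)
      (trans (^-congˡ i (x^2≈x*x t)) (^-distrib-* t t i))))

-- Application to `M n`.

module _ {c ℓ} (R : CommutativeRing c ℓ) where
  open Tridiagonal R
  open Operations P hiding (det)
  open Determinant P
  open GaussianBinomial P q using (gauss; gauss-rising)
  open Expansion P q
  open FractionSum P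

  -- `M n` is symmetric: with positions counted from 0, the exponents `i ∸ 1` above and `i ∸ 2`
  -- below the diagonal give the same sequence.
  offDiagonal : ℕ → Carrier
  offDiagonal i = √X * √q ^ i

  det-M : ∀ n → det (M n) ≈ continuant (λ i → offDiagonal i * offDiagonal i) n
  det-M n = trans
    (det-cong {n} {M n} λ i j →
      -- At successor indices `entry` computes to the nested conditional of `if-tridiagonal`.
      reflexive (if-tridiagonal offDiagonal offDiagonal (toℕ i) (toℕ j)))
    (det-tridiagonal offDiagonal offDiagonal n)

  term-denominator : ∀ n a → term X n a * denominator a ≈ numerator n a
  term-denominator n a = trans
    (*-assoc (coefficient X a) (gauss (n ∸ a) a) (denominator a))
    (*-congˡ {coefficient X a} (gauss-rising (n ∸ a) a))

theorem2 : ∀ {c ℓ} (R : CommutativeRing c ℓ) (n : ℕ) → n ≥ 1 →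
    let open Tridiagonal R in
    fromRing (det (M n)) ≈ᴷ sumᴷ {suc ⌊ n /2⌋} (λ a → summand n (toℕ a))
theorem2 R n _ = K.trans {j = fromRing (expansion X n (suc ⌊ n /2⌋))}
  (fromRing-cong (P.trans {j = continuant (λ i → offDiagonal R i P.* offDiagonal R i) n}
    (det-M R n)
    -- `≤-refl` proves that `suc ⌊ n /2⌋`, the least admissible number of terms, suffices.
    (continuant-expansion {y = X} (Squares.square-*-^ P √X √q) n ≤-refl)))
  (sum-fromRing {suc ⌊ n /2⌋} (λ a → term X n (toℕ a)) (λ a → summand n (toℕ a))
    (λ a → term-denominator R n (toℕ a)))
  where
  open Tridiagonal R
  open Determinant P using (continuant)
  open Expansion P q using (term; expansion; continuant-expansion)
  open FractionSum P
  module P = CommutativeRing P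
  module K = CommutativeRing K
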